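{- Let $z\ge 1$ be an integer and let $n[z,1;4]$ be the order of a $[z,1;4]$-mixed cage. Then $$n[z,1;4]\le\begin{cases}3(z+1) & \text{if } z \text{ is odd},\\ 3z+2 & \text{if } z \text{ is even}.\end{cases}$$ Moreover, equality holds for $z\in\{1,2\}$, i.e. $n[1,1;4]=6$ and $n[2,1;4]=8$.
   Context: A mixed graph is a finite simple graph that may contain both edges and arcs. A $[z,r;g]$-mixed graph is a mixed graph in which every vertex is the tail of exactly $z$ arcs, the head of exactly $z$ arcs, and is incident with exactly $r$ edges, and whose girth is $g$. Walks traverse edges in either direction and arcs only in their direction; a cycle is a closed walk with no repeated vertices (other than start = end) and no repeated edge or arc; the girth is the length of a shortest cycle. A $[z,r;g]$-mixed cage is a $[z,r;g]$-mixed graph of minimum order. -}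

module Defs where

open import Data.Bool.Base using (Bool; T)
open import Data.Fin.Base using (Fin)
open import Data.Fin.Subset using (∣_∣)
open import Data.List.Base using (List; []; _∷_)
open import Data.List.Relation.Unary.AllPairs using (AllPairs)
open import Data.List.Relation.Unary.Unique.Propositional using (Unique)
open import Data.Nat.Base using (ℕ; zero; suc; _≤_; _<_)
open import Data.Product.Base using (_×_; ∃; Σ-syntax)
open import Data.Vec.Base using (tabulate)
open import Level using (0ℓ)
open import Relation.Binary.Core using (Rel)
open import Relation.Binary.Construct.Closure.ReflexiveTransitive using (Star; ε; _◅_)
open import Relation.Binary.Definitions using (Symmetric; Asymmetric)
open import Relation.Binary.PropositionalEquality using (_≡_)
open import Relation.Nullary.Negation using (¬_)

-- A mixed graph on n vertices.  Simplicity is read as: no loops, and any two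
-- vertices are joined by at most one edge or arc.  A pair of opposite arcs,
-- or an edge parallel to an arc, would be a cycle of length 2, so for graphs of
-- girth at least 3 it makes no difference whether these are excluded here.
-- Loop arcs are excluded by asymmetry.
record MixedGraph (n : ℕ) : Set where
  field
    edge : Fin n → Fin n → Bool
    arc  : Fin n → Fin n → Bool

  Edge : Rel (Fin n) 0ℓ
  Edge u v = T (edge u v)

  Arc : Rel (Fin n) 0ℓ
  Arc u v = T (arc u v)

  field
    edge-sym      : Symmetric Edge
    edge-loopless : ∀ v → ¬ Edge v v
    arc-asym      : Asymmetric Arc
    edge-arc-disj : ∀ {u v} → Edge u v → ¬ Arc u v

  edgeDegree outDegree inDegree : Fin n → ℕ
  edgeDegree v = ∣ tabulate (λ u → edge v u) ∣
  outDegree  v = ∣ tabulate (λ u → arc v u) ∣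
  inDegree   v = ∣ tabulate (λ u → arc u v) ∣

data Link (n : ℕ) : Set where
  edgeLink arcLink : Fin n → Fin n → Link n

-- An edge is the same edge whichever way it is traversed.
data SameLink {n : ℕ} : Rel (Link n) 0ℓ where
  same     : ∀ {l} → SameLink l l
  reversed : ∀ {u v} → SameLink (edgeLink u v) (edgeLink v u)

module _ {n : ℕ} (G : MixedGraph n) where
  open MixedGraph G

  data Step : Rel (Fin n) 0ℓ where
    along-edge : ∀ {u v} → Edge u v → Step u v
    along-arc  : ∀ {u v} → Arc u v → Step u v

  Walk : Rel (Fin n) 0ℓ
  Walk = Star Step

module _ {n : ℕ} {G : MixedGraph n} where

  link : ∀ {u v} → Step G u v → Link n
  link {u} {v} (along-edge _) = edgeLink u v
  link {u} {v} (along-arc _)  = arcLink u v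

  links : ∀ {u v} → Walk G u v → List (Link n)
  links ε       = []
  links (s ◅ w) = link s ∷ links w

  -- All vertices of a walk except its final one.
  vertices : ∀ {u v} → Walk G u v → List (Fin n)
  vertices ε             = []
  vertices (_◅_ {u} s w) = u ∷ vertices w

  walkLength : ∀ {u v} → Walk G u v → ℕ
  walkLength ε       = zero
  walkLength (s ◅ w) = suc (walkLength w)

  record IsCycle {v : Fin n} (w : Walk G v v) : Set where
    field
      nonempty           : 0 < walkLength w
      no-repeated-vertex : Unique (vertices w)
      no-repeated-link   : AllPairs (λ l l′ → ¬ SameLink l l′) (links w)

HasGirth : ∀ {n} → MixedGraph n → ℕ → Set
HasGirth {n} G g =
  (Σ[ v ∈ Fin n ] Σ[ w ∈ Walk G v v ] (IsCycle w × walkLength w ≡ g)) ×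
  (∀ {v} (w : Walk G v v) → IsCycle w → g ≤ walkLength w)

record Is[_,_⨟_]MixedGraph (z r g : ℕ) {n : ℕ} (G : MixedGraph n) : Set where
  open MixedGraph G
  field
    out-regular  : ∀ v → outDegree v ≡ z
    in-regular   : ∀ v → inDegree v ≡ z
    edge-regular : ∀ v → edgeDegree v ≡ r
    girth        : HasGirth G g

record Is[_,_⨟_]MixedCage (z r g : ℕ) {n : ℕ} (G : MixedGraph n) : Set where
  field
    isMixedGraph : Is[ z , r ⨟ g ]MixedGraph G
    minimum      : ∀ {m} (H : MixedGraph m) → Is[ z , r ⨟ g ]MixedGraph H → n ≤ m

-- n[z,r;g] = n, where n[z,r;g] is the common order of all [z,r;g]-mixed cages.
n[_,_⨟_]≐_ : ℕ → ℕ → ℕ → ℕ → Set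
n[ z , r ⨟ g ]≐ n = ∃ λ (G : MixedGraph n) → Is[ z , r ⨟ g ]MixedCage G

{-# OPTIONS --safe #-}
module Submission where

-- Upper bound: with k = ⌈z/2⌉, l = ⌊z/2⌋ and h = 2k + l + 1, take the circulant graph on ℤ/2h in
-- which u has arcs to u + d for d in {1,…,k} ∪ {h+1,…,h+l} and an edge to u + h.  No three of
-- these differences add up to a multiple of 2h, whereas k + k + 1 + (h + l) = 2h gives a cycle of
-- length 4.  The minimum order exists constructively because having girth 4 is decidable: it means
-- having a 4-cycle and no triangle.
--
-- Lower bound: if v → u, then the in-degrees being equal, some in-neighbour x of v is not an
-- in-neighbour of u; x is not adjacent to u, since that would close a triangle.  Hence the order
-- is at least 2z + 3, and it is even as the edges form a perfect matching.

open import Defs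
open import Data.Bool.Base using (Bool; true; false; T; _∨_; if_then_else_)
open import Data.Bool.Properties using (T-≡; T-∨; T?)
open import Data.Empty using (⊥-elim)
open import Data.Fin.Base using (Fin; zero; suc; toℕ; fromℕ<; combine; remQuot)
open import Data.Fin.Properties using (any?; all?; remQuot-combine; toℕ<n; toℕ-fromℕ<)
  renaming (_≟_ to _≟ᶠ_)
open import Data.Fin.Subset using (Subset; ∣_∣; _∈_)
open import Data.Fin.Subset.Properties using (p⊂q⇒∣p∣<∣q∣; ∣p∣≤n; anySubset?)
open import Data.List.Relation.Unary.All using ([]; _∷_)
open import Data.List.Relation.Unary.AllPairs using ([]; _∷_)
open import Data.Nat.Base
open import Data.Nat.Divisibility
open import Data.Nat.DivMod
open import Data.Nat.Properties
open import Data.Nat.Tactic.RingSolver using (solve-∀)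
open import Data.Product.Base
open import Data.Sum.Base using (_⊎_; inj₁; inj₂; [_,_]′)
open import Data.Unit.Base using (tt)
open import Data.Vec.Base using (tabulate; lookup)
open import Data.Vec.Properties using (lookup∘tabulate; lookup⇒[]=; []=⇒lookup; tabulate-cong)
open import Function.Base using (_∘_; id)
open import Function.Bundles using (Equivalence)
open import Relation.Binary.Construct.Closure.ReflexiveTransitive using (ε; _◅_)
open import Relation.Binary.Definitions using (tri<; tri≈; tri>)
open import Relation.Binary.PropositionalEquality
open import Relation.Nullary
open import Relation.Nullary.Decidable
  using (_×-dec_; _⊎-dec_; _→-dec_; ¬?; map′; ⌊_⌋; toWitness; fromWitness; decidable-stable)
open import Relation.Unary using (Pred; Decidable)
open import Algebra.Properties.CommutativeMonoid.Sum +-0-commutativeMonoid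
  using (sum; sum-cong-≗; ∑-distrib-+)

private variable n : ℕ

-- Counting, and the parity of degree sums

# : (Fin n → Bool) → ℕ
# f = ∣ tabulate f ∣

bit : Bool → ℕ
bit b = if b then 1 else 0

#-suc : (f : Fin (suc n) → Bool) → # f ≡ bit (f zero) + # (f ∘ suc)
#-suc f with f zero
... | true  = refl
... | false = refl

#-cong : {f g : Fin n → Bool} → (∀ i → f i ≡ g i) → # f ≡ # g
#-cong f≗g = cong ∣_∣ (tabulate-cong f≗g)

-- Finite sums add pointwise; `handshake` and the count of a disjoint union go through this form.
#≡sum : (f : Fin n → Bool) → # f ≡ sum (bit ∘ f)
#≡sum {zero}  f = refl
#≡sum {suc n} f = trans (#-suc f) (cong (bit (f zero) +_) (#≡sum (f ∘ suc)))

∈-tabulate⁺ : (f : Fin n → Bool) {i : Fin n} → T (f i) → i ∈ tabulate f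
∈-tabulate⁺ f {i} t =
  lookup⇒[]= i (tabulate f) (trans (lookup∘tabulate f i) (Equivalence.to T-≡ t))

∈-tabulate⁻ : (f : Fin n → Bool) {i : Fin n} → i ∈ tabulate f → T (f i)
∈-tabulate⁻ f {i} i∈ =
  Equivalence.from T-≡ (trans (sym (lookup∘tabulate f i)) ([]=⇒lookup i∈))

#-strict : (f g : Fin n → Bool) {x : Fin n} → (∀ i → T (f i) → T (g i)) →
           T (g x) → ¬ T (f x) → # f < # g
#-strict f g {x} f⊆g gx ¬fx = p⊂q⇒∣p∣<∣q∣
  ( (λ i∈ → ∈-tabulate⁺ g (f⊆g _ (∈-tabulate⁻ f i∈)))
  , x , ∈-tabulate⁺ g gx , ¬fx ∘ ∈-tabulate⁻ f )

#>0⇒∃ : (f : Fin n → Bool) → 0 < # f → ∃ λ i → T (f i)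
#>0⇒∃ {suc n} f 0<#f with f zero in eq
... | true  = zero , Equivalence.from T-≡ eq
... | false = map suc id (#>0⇒∃ (f ∘ suc) 0<#f)

bit-∨ : ∀ a b → (T a → ¬ T b) → bit (a ∨ b) ≡ bit a + bit b
bit-∨ true  true  a∩b=∅ = ⊥-elim (a∩b=∅ tt tt)
bit-∨ true  false _     = refl
bit-∨ false b     _     = refl

#-∨ : (f g : Fin n → Bool) → (∀ i → T (f i) → ¬ T (g i)) →
      # (λ i → f i ∨ g i) ≡ # f + # g
#-∨ f g f∩g=∅ = begin
  # (λ i → f i ∨ g i)                   ≡⟨ #≡sum (λ i → f i ∨ g i) ⟩
  sum (λ i → bit (f i ∨ g i))           ≡⟨ sum-cong-≗ (λ i → bit-∨ (f i) (g i) (f∩g=∅ i)) ⟩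
  sum (λ i → bit (f i) + bit (g i))     ≡⟨ ∑-distrib-+ (bit ∘ f) (bit ∘ g) ⟩
  sum (bit ∘ f) + sum (bit ∘ g)         ≡⟨ cong₂ _+_ (#≡sum f) (#≡sum g) ⟨
  # f + # g                             ∎
  where open ≡-Reasoning

-- Induction on the number of vertices: deleting vertex `zero` removes its row and its column, which
-- by symmetry hold equally many entries, and the diagonal entry is 0. So the total drops by the
-- even number `2 * r`.
handshake : (f : Fin n → Fin n → Bool) → (∀ i j → f i j ≡ f j i) →
            (∀ i → f i i ≡ false) → 2 ∣ sum (λ i → # (f i))
handshake {zero}  f f-sym f-irr = 2 ∣0
handshake {suc n} f f-sym f-irr =
  subst (2 ∣_) (sym total) (∣m∣n⇒∣m+n (m∣m*n r) ih)
  where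
  open ≡-Reasoning
  f′ : Fin n → Fin n → Bool
  f′ i j = f (suc i) (suc j)

  r = # (f zero ∘ suc)

  ih : 2 ∣ sum (λ i → # (f′ i))
  ih = handshake f′ (λ i j → f-sym (suc i) (suc j)) (λ i → f-irr (suc i))

  column : sum (λ i → bit (f (suc i) zero)) ≡ r
  column = begin
    sum (λ i → bit (f (suc i) zero))  ≡⟨ sum-cong-≗ (λ i → cong bit (f-sym (suc i) zero)) ⟩
    sum (λ i → bit (f zero (suc i)))  ≡⟨ #≡sum (f zero ∘ suc) ⟨
    r                                 ∎

  total : sum (λ i → # (f i)) ≡ 2 * r + sum (λ i → # (f′ i))
  total = begin
    # (f zero) + sum (λ i → # (f (suc i)))
      ≡⟨ cong₂ _+_ (trans (#-suc (f zero)) (cong (λ b → bit b + r) (f-irr zero)))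
                   (sum-cong-≗ (λ i → #-suc (f (suc i)))) ⟩
    r + sum (λ i → bit (f (suc i) zero) + # (f′ i))
      ≡⟨ cong (r +_) (∑-distrib-+ (λ i → bit (f (suc i) zero)) (λ i → # (f′ i))) ⟩
    r + (sum (λ i → bit (f (suc i) zero)) + sum (λ i → # (f′ i)))
      ≡⟨ cong (λ c → r + (c + sum (λ i → # (f′ i)))) column ⟩
    r + (r + sum (λ i → # (f′ i)))
      ≡⟨ +-assoc r r _ ⟨
    r + r + sum (λ i → # (f′ i))
      ≡⟨ cong (λ s → r + s + sum (λ i → # (f′ i))) (+-identityʳ r) ⟨
    2 * r + sum (λ i → # (f′ i)) ∎

T-ext : ∀ {a b} → (T a → T b) → (T b → T a) → a ≡ b
T-ext {true}  {true}  _ _ = refl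
T-ext {true}  {false} f _ = ⊥-elim (f tt)
T-ext {false} {true}  _ g = ⊥-elim (g tt)
T-ext {false} {false} _ _ = refl

¬T⇒false : ∀ {b} → ¬ T b → b ≡ false
¬T⇒false {true}  ¬t = ⊥-elim (¬t tt)
¬T⇒false {false} _  = refl

sum-ones : (f : Fin n → ℕ) → (∀ i → f i ≡ 1) → sum f ≡ n
sum-ones {zero}  f f≗1 = refl
sum-ones {suc n} f f≗1 = cong₂ _+_ (f≗1 zero) (sum-ones (f ∘ suc) (f≗1 ∘ suc))

-- Girth 4 in terms of 4-cycles and triangles

module _ (G : MixedGraph n) where
  open MixedGraph G

  TriangleFree : Set
  TriangleFree = ∀ a b c → Step G a b → Step G b c → ¬ Step G c a

  FourCycle : Set
  FourCycle = ∃ λ a → ∃ λ b → ∃ λ c → ∃ λ d →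
    (a ≢ b × a ≢ c × a ≢ d × b ≢ c × b ≢ d × c ≢ d) ×
    (Step G a b × Step G b c × Step G c d × Step G d a)

  step-irrefl : ∀ {u v} → Step G u v → u ≢ v
  step-irrefl (along-edge e) refl = edge-loopless _ e
  step-irrefl (along-arc a)  refl = arc-asym a a

link-source : ∀ {G : MixedGraph n} {u v x y} (s : Step G u v) (t : Step G x y) →
              SameLink (link s) (link t) → u ≡ x ⊎ (u ≡ y × v ≡ x)
link-source (along-edge _) (along-edge _) same     = inj₁ refl
link-source (along-edge _) (along-edge _) reversed = inj₂ (refl , refl)
link-source (along-arc _)  (along-arc _)  same     = inj₁ refl

-- Equal links have equal sources or are one edge traversed in both directions, so inequalities
-- between end points are enough to separate two links of a cycle.
links-differ : ∀ {G : MixedGraph n} {u v x y} (s : Step G u v) (t : Step G x y) →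
               u ≢ x → (u ≢ y ⊎ v ≢ x) → ¬ SameLink (link s) (link t)
links-differ s t u≢x u≢y⊎v≢x sl with link-source s t sl | u≢y⊎v≢x
... | inj₁ u≡x         | _        = u≢x u≡x
... | inj₂ (u≡y , _)   | inj₁ u≢y = u≢y u≡y
... | inj₂ (_   , v≡x) | inj₂ v≢x = v≢x v≡x

module _ {G : MixedGraph n} where
  open MixedGraph G

  girth4⁺ : FourCycle G → TriangleFree G → HasGirth G 4
  girth4⁺ (a , b , c , d , (ab , ac , ad , bc , bd , cd) , (s , t , u , v)) tf =
    (a , (s ◅ t ◅ u ◅ v ◅ ε) , cycle , refl) , shortest
    where
    cycle : IsCycle (s ◅ t ◅ u ◅ v ◅ ε)
    cycle = record
      { nonempty = z<s
      ; no-repeated-vertex =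
          (ab ∷ ac ∷ ad ∷ []) ∷ (bc ∷ bd ∷ []) ∷ (cd ∷ []) ∷ [] ∷ []
      ; no-repeated-link =
          (links-differ s t ab (inj₁ ac) ∷ links-differ s u ac (inj₁ ad) ∷
            links-differ s v ad (inj₂ bd) ∷ []) ∷
          (links-differ t u bc (inj₁ bd) ∷ links-differ t v bd (inj₂ cd) ∷ []) ∷
          (links-differ u v cd (inj₁ (ac ∘ sym)) ∷ []) ∷ [] ∷ []
      }

    shortest : ∀ {v} (w : Walk G v v) → IsCycle w → 4 ≤ walkLength w
    shortest ε cyc = ⊥-elim (n≮n 0 (IsCycle.nonempty cyc))
    shortest (s ◅ ε) cyc = ⊥-elim (step-irrefl G s refl)
    -- A closed walk along two edges traverses one edge forth and back, hence repeats a link. In the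
    -- other closed walks of length 2, an edge lies parallel to an arc or two arcs are opposite.
    shortest (along-edge e ◅ along-edge e′ ◅ ε) cyc with IsCycle.no-repeated-link cyc
    ... | (differ ∷ []) ∷ _ = ⊥-elim (differ reversed)
    shortest (along-edge e ◅ along-arc a ◅ ε) cyc = ⊥-elim (edge-arc-disj (edge-sym e) a)
    shortest (along-arc a ◅ along-edge e ◅ ε) cyc = ⊥-elim (edge-arc-disj (edge-sym e) a)
    shortest (along-arc a ◅ along-arc a′ ◅ ε) cyc = ⊥-elim (arc-asym a a′)
    shortest (s ◅ t ◅ u ◅ ε) cyc = ⊥-elim (tf _ _ _ s t u)
    shortest (_ ◅ _ ◅ _ ◅ _ ◅ w) cyc = s≤s (s≤s (s≤s (s≤s z≤n)))

  girth4⇒fourCycle : HasGirth G 4 → FourCycle G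
  girth4⇒fourCycle ((v , (s ◅ t ◅ u ◅ w ◅ ε) , cyc , refl) , _)
    with IsCycle.no-repeated-vertex cyc
  ... | (ab ∷ ac ∷ ad ∷ []) ∷ (bc ∷ bd ∷ []) ∷ (cd ∷ []) ∷ _ =
    _ , _ , _ , _ , (ab , ac , ad , bc , bd , cd) , (s , t , u , w)

  -- Every step joins distinct vertices, so three steps that close up form a genuine cycle, of
  -- length 3 < 4.
  girth4⇒triangleFree : HasGirth G 4 → TriangleFree G
  girth4⇒triangleFree (_ , shortest) a b c s t u =
    <⇒≱ {3} {4} ≤-refl (shortest (s ◅ t ◅ u ◅ ε) record
      { nonempty = z<s
      ; no-repeated-vertex = (ab ∷ ac ∷ []) ∷ (bc ∷ []) ∷ [] ∷ []
      ; no-repeated-link =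
          (links-differ s t ab (inj₁ ac) ∷ links-differ s u ac (inj₂ bc) ∷ []) ∷
          (links-differ t u bc (inj₁ (ab ∘ sym)) ∷ []) ∷ [] ∷ []
      })
    where
    ab = step-irrefl G s
    bc = step-irrefl G t
    ac = step-irrefl G u ∘ sym

-- Lower bound for the order

module _ {z : ℕ} {G : MixedGraph n} (G-mixed : Is[ z , 1 ⨟ 4 ]MixedGraph G) where
  open MixedGraph G
  open Is[_,_⨟_]MixedGraph G-mixed

  -- All edge degrees are 1, so the sum of the edge degrees is the order itself.
  order-even : 2 ∣ n
  order-even = subst (2 ∣_) (sum-ones edgeDegree edge-regular)
    (handshake edge (λ u v → T-ext edge-sym edge-sym) (λ v → ¬T⇒false (edge-loopless v)))

  -- The in-neighbours, the out-neighbours and the edge neighbour of `u` are `z + z + 1` different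
  -- vertices; `u` and `x` are two further ones.
  nonneighbour⇒2z+3≤n : ∀ {u x} → x ≢ u → ¬ Arc x u → ¬ Arc u x → ¬ Edge u x →
                        2 + (z + z + 1) ≤ n
  nonneighbour⇒2z+3≤n {u} {x} x≢u x↛u u↛x u≁x = begin
    2 + (z + z + 1)        ≡⟨ cong (2 +_) #adjacent ⟨
    2 + # adjacent         ≤⟨ s≤s (#-strict adjacent closed {u} (λ w → Equivalence.from T-∨ ∘ inj₁)
                                (Equivalence.from (T-∨ {adjacent u}) (inj₂ (fromWitness refl)))
                                u-not-adjacent) ⟩
    1 + # closed           ≤⟨ #-strict closed (λ _ → true) {x} _ _ x-not-in-closed ⟩
    # {n} (λ _ → true)     ≤⟨ ∣p∣≤n (tabulate (λ _ → true)) ⟩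
    n                      ∎
    where
    open ≤-Reasoning
    arcs adjacent closed : Fin n → Bool
    arcs w = arc w u ∨ arc u w
    adjacent w = arcs w ∨ edge u w
    closed w = adjacent w ∨ ⌊ w ≟ᶠ u ⌋

    arcs∩edges=∅ : ∀ w → T (arcs w) → ¬ Edge u w
    arcs∩edges=∅ w t e with Equivalence.to T-∨ t
    ... | inj₁ w→u = edge-arc-disj (edge-sym e) w→u
    ... | inj₂ u→w = edge-arc-disj e u→w

    #adjacent : # adjacent ≡ z + z + 1
    #adjacent = trans (#-∨ arcs (edge u) arcs∩edges=∅) (cong₂ _+_
      (trans (#-∨ (λ w → arc w u) (arc u) (λ w → arc-asym))
             (cong₂ _+_ (in-regular u) (out-regular u)))
      (edge-regular u))

    u-not-adjacent : ¬ T (adjacent u)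
    u-not-adjacent t with Equivalence.to T-∨ t
    ... | inj₂ e = edge-loopless u e
    ... | inj₁ t′ with Equivalence.to T-∨ t′
    ... | inj₁ a = arc-asym a a
    ... | inj₂ a = arc-asym a a

    x-not-in-closed : ¬ T (closed x)
    x-not-in-closed t with Equivalence.to T-∨ t
    ... | inj₂ x≟u = x≢u (toWitness x≟u)
    ... | inj₁ t′ with Equivalence.to T-∨ t′
    ... | inj₂ e = u≁x e
    ... | inj₁ t″ with Equivalence.to T-∨ t″
    ... | inj₁ x→u = x↛u x→u
    ... | inj₂ u→x = u↛x u→x

  -- If every in-neighbour of v were an in-neighbour of u, then u, having v as a further
  -- in-neighbour, would have larger in-degree than v.
  missing-in-neighbour : ∀ {v u} → Arc v u → ∃ λ x → Arc x v × ¬ Arc x u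
  missing-in-neighbour {v} {u} v→u with any? (λ x → T? (arc x v) ×-dec ¬? (T? (arc x u)))
  ... | yes found = found
  ... | no none = ⊥-elim (<-irrefl (trans (in-regular v) (sym (in-regular u)))
    (#-strict (λ x → arc x v) (λ x → arc x u) {v} In-v⊆In-u v→u (λ a → arc-asym a a)))
    where
    In-v⊆In-u : ∀ x → Arc x v → Arc x u
    In-v⊆In-u x x→v = decidable-stable (T? (arc x u)) (λ x↛u → none (x , x→v , x↛u))

  2z+3≤n : 1 ≤ z → 2 + (z + z + 1) ≤ n
  2z+3≤n 1≤z =
    -- The 4-cycle guarantees that there is a vertex to start from.
    let v , _       = girth4⇒fourCycle girth
        u , v→u     = #>0⇒∃ (arc v) (subst (0 <_) (sym (out-regular v)) 1≤z)
        x , x→v , x↛u = missing-in-neighbour v→u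
        -- Any step from `u` to `x` would close the triangle `v`, `u`, `x`.
        no-return   = λ s → girth4⇒triangleFree girth v u x (along-arc v→u) s (along-arc x→v)
    in nonneighbour⇒2z+3≤n (λ x≡u → arc-asym v→u (subst (λ w → Arc w v) x≡u x→v)) x↛u
         (no-return ∘ along-arc) (no-return ∘ along-edge)

  -- The bound 2z + 3 is odd and the order is even, so the bound is not attained.
  2z+4≤n : 1 ≤ z → 2 * (z + 2) ≤ n
  2z+4≤n 1≤z = subst (_≤ n) (l₂ z) (≤∧≢⇒< (2z+3≤n 1≤z) odd≢n)
    where
    l₁ : ∀ z → 2 + (z + z + 1) ≡ 2 * (z + 1) + 1
    l₁ = solve-∀
    l₂ : ∀ z → 3 + (z + z + 1) ≡ 2 * (z + 2)
    l₂ = solve-∀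
    odd≢n : 2 + (z + z + 1) ≢ n
    odd≢n eq = <⇒≱ (n<1+n 1) (∣⇒≤ (∣m+n∣m⇒∣n
      (subst (2 ∣_) (trans (sym eq) (l₁ z)) order-even) (m∣m*n (z + 1))))

-- Decidability and the existence of a minimum order

step? : (G : MixedGraph n) → ∀ u v → Dec (Step G u v)
step? G u v = map′ [ along-edge , along-arc ]′
  (λ { (along-edge e) → inj₁ e ; (along-arc a) → inj₂ a })
  (T? (edge u v) ⊎-dec T? (arc u v))
  where open MixedGraph G

triangleFree? : (G : MixedGraph n) → Dec (TriangleFree G)
triangleFree? G = all? λ a → all? λ b → all? λ c →
  step? G a b →-dec step? G b c →-dec ¬? (step? G c a)

fourCycle? : (G : MixedGraph n) → Dec (FourCycle G)
fourCycle? G = any? λ a → any? λ b → any? λ c → any? λ d →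
  (a ≢? b ×-dec a ≢? c ×-dec a ≢? d ×-dec b ≢? c ×-dec b ≢? d ×-dec c ≢? d) ×-dec
  (step? G a b ×-dec step? G b c ×-dec step? G c d ×-dec step? G d a)
  where
  infix 4 _≢?_
  _≢?_ : (u v : Fin _) → Dec (u ≢ v)
  u ≢? v = ¬? (u ≟ᶠ v)

isMixedGraph? : ∀ z r (G : MixedGraph n) → Dec (Is[ z , r ⨟ 4 ]MixedGraph G)
isMixedGraph? z r G = map′
  (λ (o , i , e , c , t) → record
    { out-regular = o ; in-regular = i ; edge-regular = e ; girth = girth4⁺ c t })
  (λ m → let open Is[_,_⨟_]MixedGraph m in
    out-regular , in-regular , edge-regular ,
    girth4⇒fourCycle girth , girth4⇒triangleFree girth)
  (all? (λ v → outDegree v ≟ z) ×-dec all? (λ v → inDegree v ≟ z) ×-dec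
   all? (λ v → edgeDegree v ≟ r) ×-dec fourCycle? G ×-dec triangleFree? G)
  where open MixedGraph G

infix 4 _≗₂_
_≗₂_ : (f g : Fin n → Fin n → Bool) → Set
f ≗₂ g = ∀ u v → f u v ≡ g u v

module _ (G H : MixedGraph n) where
  private
    module G = MixedGraph G
    module H = MixedGraph H

  -- `G` and `H` agree only pointwise and may carry different proofs in their fields, so the
  -- property is carried over step by step instead of along an equality of graphs.
  isMixedGraph-resp : ∀ {z r} → G.edge ≗₂ H.edge → G.arc ≗₂ H.arc →
                      Is[ z , r ⨟ 4 ]MixedGraph G → Is[ z , r ⨟ 4 ]MixedGraph H
  isMixedGraph-resp edge≗ arc≗ G-mixed = record
    { out-regular  = λ v → trans (sym (#-cong (arc≗ v))) (out-regular v)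
    ; in-regular   = λ v → trans (sym (#-cong (λ u → arc≗ u v))) (in-regular v)
    ; edge-regular = λ v → trans (sym (#-cong (edge≗ v))) (edge-regular v)
    ; girth        = girth4⁺
        (map₂ (map₂ (map₂ (map₂ (map₂ (λ (s , t , u , v) → to s , to t , to u , to v)))))
              (girth4⇒fourCycle girth))
        (λ a b c s t u → girth4⇒triangleFree girth a b c (from s) (from t) (from u))
    }
    where
    open Is[_,_⨟_]MixedGraph G-mixed
    to : ∀ {u v} → Step G u v → Step H u v
    to (along-edge e) = along-edge (subst T (edge≗ _ _) e)
    to (along-arc a)  = along-arc (subst T (arc≗ _ _) a)

    from : ∀ {u v} → Step H u v → Step G u v
    from (along-edge e) = along-edge (subst T (sym (edge≗ _ _)) e)
    from (along-arc a)  = along-arc (subst T (sym (arc≗ _ _)) a)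

Realisable : (z r n : ℕ) → Set
Realisable z r n = ∃ λ (G : MixedGraph n) → Is[ z , r ⨟ 4 ]MixedGraph G

Presents : MixedGraph n → (e a : Fin n → Fin n → Bool) → Set
Presents G e a = MixedGraph.edge G ≗₂ e × MixedGraph.arc G ≗₂ a

mixedGraph? : (e a : Fin n → Fin n → Bool) → Dec (∃ λ G → Presents G e a)
mixedGraph? e a = map′
  (λ (es , el , aa , d) → record
    { edge = e ; arc = a ; edge-sym = es _ _ ; edge-loopless = el
    ; arc-asym = aa _ _ ; edge-arc-disj = d _ _ } , (λ _ _ → refl) , (λ _ _ → refl))
  (λ (G , e≗ , a≗) → let open MixedGraph G in
      (λ u v e → subst T (e≗ v u) (edge-sym (subst T (sym (e≗ u v)) e)))
    , (λ v e → edge-loopless v (subst T (sym (e≗ v v)) e))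
    , (λ u v a a′ → arc-asym (subst T (sym (a≗ u v)) a) (subst T (sym (a≗ v u)) a′))
    , (λ u v e a → edge-arc-disj (subst T (sym (e≗ u v)) e) (subst T (sym (a≗ u v)) a)))
  ( all? (λ u → all? λ v → T? (e u v) →-dec T? (e v u))
    ×-dec all? (λ v → ¬? (T? (e v v)))
    ×-dec all? (λ u → all? λ v → T? (a u v) →-dec ¬? (T? (a v u)))
    ×-dec all? (λ u → all? λ v → T? (e u v) →-dec ¬? (T? (a u v))))

-- All graphs with the same pair of matrices have the property together, so it suffices to test one
-- of them.
presented? : ∀ z r (e a : Fin n → Fin n → Bool) →
             Dec (∃ λ G → Presents G e a × Is[ z , r ⨟ 4 ]MixedGraph G)
presented? z r e a with mixedGraph? e a
... | no ¬G = no (λ (G , p , _) → ¬G (G , p))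
... | yes (H , e≗ , a≗) = map′
  (λ m → H , (e≗ , a≗) , m)
  (λ (G , (e≗′ , a≗′) , m) → isMixedGraph-resp G H
     (λ u v → trans (e≗′ u v) (sym (e≗ u v))) (λ u v → trans (a≗′ u v) (sym (a≗ u v))) m)
  (isMixedGraph? z r H)

-- A relation on n vertices is encoded as a subset of n * n points, because all subsets of a finite
-- set can be searched. A graph then is a pair of subsets, up to pointwise equality.
matrix : Subset (n * n) → Fin n → Fin n → Bool
matrix p u v = lookup p (combine u v)

code : (Fin n → Fin n → Bool) → Subset (n * n)
code {n} f = tabulate (uncurry f ∘ remQuot {n} n)

matrix-code : (f : Fin n → Fin n → Bool) → f ≗₂ matrix (code f)
matrix-code {n} f u v = sym (trans (lookup∘tabulate (uncurry f ∘ remQuot {n} n) (combine u v))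
  (cong (uncurry f) (remQuot-combine {n} {n} u v)))

realisable? : ∀ z r → Decidable (Realisable z r)
realisable? z r n = map′
  (λ (_ , _ , G , _ , m) → G , m)
  (λ (G , m) → code (MixedGraph.edge G) , code (MixedGraph.arc G) ,
     G , (matrix-code (MixedGraph.edge G) , matrix-code (MixedGraph.arc G)) , m)
  (anySubset? λ p → anySubset? λ q → presented? {n} z r (matrix p) (matrix q))

-- Searches upwards from 0; the known witness `b` bounds the search and is what the recursion
-- descends on.
least : ∀ {p} {P : Pred ℕ p} → Decidable P → ∀ b → P b →
        ∃ λ m → m ≤ b × P m × (∀ {k} → P k → m ≤ k)
least P? zero    p = zero , z≤n , p , λ _ → z≤n
least P? (suc b) p with P? zero
... | yes p₀ = zero , z≤n , p₀ , λ _ → z≤n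
... | no ¬p₀ with m , m≤b , pm , m-min ← least (P? ∘ suc) b p =
  suc m , s≤s m≤b , pm , λ { {zero} p₀ → ⊥-elim (¬p₀ p₀) ; {suc k} pk → s≤s (m-min pk) }

cage : ∀ {z r b} → Realisable z r b → ∃ λ m → m ≤ b × (n[ z , r ⨟ 4 ]≐ m)
cage {z} {r} {b} realised with m , m≤b , (G , G-mixed) , m-min ← least (realisable? z r) b realised =
  m , m≤b , G , record { isMixedGraph = G-mixed ; minimum = λ H H-mixed → m-min (H , H-mixed) }

-- Counting in windows of consecutive numbers

#-snoc : ∀ (P : ℕ → Bool) n → # {suc n} (P ∘ toℕ) ≡ # {n} (P ∘ toℕ) + bit (P n)
#-snoc P zero    = trans (#-suc {zero} (P ∘ toℕ)) (+-comm (bit (P 0)) 0)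
#-snoc P (suc n) = begin
  # {2+ n} (P ∘ toℕ)                                     ≡⟨ #-suc {suc n} (P ∘ toℕ) ⟩
  bit (P 0) + # {suc n} (P ∘ suc ∘ toℕ)                  ≡⟨ cong (bit (P 0) +_) (#-snoc (P ∘ suc) n) ⟩
  bit (P 0) + (# {n} (P ∘ suc ∘ toℕ) + bit (P (suc n)))  ≡⟨ +-assoc (bit (P 0)) _ _ ⟨
  bit (P 0) + # {n} (P ∘ suc ∘ toℕ) + bit (P (suc n))    ≡⟨ cong (_+ bit (P (suc n))) (#-suc {n} (P ∘ toℕ)) ⟨
  # {suc n} (P ∘ toℕ) + bit (P (suc n))                  ∎
  where open ≡-Reasoning

-- Sliding a window of length n by one place loses `P c` at the front and gains `P (c + n)` at the
-- end, and these agree by periodicity.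
#-rotate : ∀ (P : ℕ → Bool) n → (∀ x → P (x + n) ≡ P x) → ∀ c →
           # {n} (λ i → P (c + toℕ i)) ≡ # {n} (P ∘ toℕ)
#-rotate P n periodic zero    = refl
#-rotate P n periodic (suc c) = trans (+-cancelˡ-≡ (bit (P c)) _ _ shift) (#-rotate P n periodic c)
  where
  open ≡-Reasoning
  Q : ℕ → Bool
  Q x = P (c + x)

  Q0≡P : P (c + 0) ≡ P c
  Q0≡P = cong P (+-identityʳ c)

  shift : bit (P c) + # {n} (λ i → P (suc c + toℕ i)) ≡ bit (P c) + # {n} (Q ∘ toℕ)
  shift = begin
    bit (P c) + # {n} (λ i → P (suc c + toℕ i))
      ≡⟨ cong₂ _+_ (cong bit Q0≡P) (#-cong {n} (λ i → cong P (+-suc c (toℕ i)))) ⟨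
    bit (Q 0) + # {n} (Q ∘ suc ∘ toℕ)   ≡⟨ #-suc {n} (Q ∘ toℕ) ⟨
    # {suc n} (Q ∘ toℕ)                 ≡⟨ #-snoc Q n ⟩
    # {n} (Q ∘ toℕ) + bit (P (c + n))   ≡⟨ cong (λ b → # {n} (Q ∘ toℕ) + bit b) (periodic c) ⟩
    # {n} (Q ∘ toℕ) + bit (P c)         ≡⟨ +-comm _ (bit (P c)) ⟩
    bit (P c) + # {n} (Q ∘ toℕ)         ∎

-- Both sides count over the window from c + 1 to c + n, the left one in descending order.
#-reflect : ∀ (P : ℕ → Bool) n c →
            # {n} (λ i → P ((n ∸ toℕ i) + c)) ≡ # {n} (λ i → P (suc c + toℕ i))
#-reflect P zero    c = refl
#-reflect P (suc n) c = begin
  # {suc n} (λ i → P ((suc n ∸ toℕ i) + c))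
    ≡⟨ #-suc {n} (λ i → P ((suc n ∸ toℕ i) + c)) ⟩
  bit (P (suc n + c)) + # {n} (λ i → P ((n ∸ toℕ i) + c))
    ≡⟨ cong₂ _+_ (cong (bit ∘ P ∘ suc) (+-comm n c)) (#-reflect P n c) ⟩
  bit (P (suc c + n)) + # {n} (λ i → P (suc c + toℕ i))
    ≡⟨ +-comm (bit (P (suc c + n))) _ ⟩
  # {n} (λ i → P (suc c + toℕ i)) + bit (P (suc c + n))
    ≡⟨ #-snoc (λ x → P (suc c + x)) n ⟨
  # {suc n} (λ i → P (suc c + toℕ i)) ∎
  where open ≡-Reasoning

-- The indicator of the half-open interval from `a` to `a + l`: the second argument is the length
-- and not the end point.
interval : ℕ → ℕ → ℕ → Bool
interval zero    l x       = x <ᵇ l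
interval (suc a) l zero    = false
interval (suc a) l (suc x) = interval a l x

∈-interval⁻ : ∀ a l x → T (interval a l x) → ∃ λ j → j < l × x ≡ a + j
∈-interval⁻ zero    l x       t = x , <ᵇ⇒< x l t , refl
∈-interval⁻ (suc a) l (suc x) t = map₂ (map₂ (cong suc)) (∈-interval⁻ a l x t)

∈-interval⁺ : ∀ a l {j} → j < l → T (interval a l (a + j))
∈-interval⁺ zero    l j<l = <⇒<ᵇ j<l
∈-interval⁺ (suc a) l j<l = ∈-interval⁺ a l j<l

#-interval : ∀ a l n → a + l ≤ n → # {n} (interval a l ∘ toℕ) ≡ l
#-interval zero    zero    zero    _         = refl
#-interval zero    zero    (suc n) _         = #-interval zero zero n z≤n
#-interval zero    (suc l) (suc n) (s≤s l≤n) = cong suc (#-interval zero l n l≤n)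
#-interval (suc a) l       (suc n) (s≤s a+l≤n) = #-interval a l n a+l≤n

-- Differences modulo n

module Cyclic (n : ℕ) .{{_ : NonZero n}} where

  -- The residue of v - u. Subtracting `u` from n, which exceeds it, avoids truncation.
  diff : Fin n → Fin n → ℕ
  diff u v = ((n ∸ toℕ u) + toℕ v) % n

  -- For fixed `u` the numbers that `diff` reduces fill a window of length n as `v` varies, so each
  -- residue occurs once. This makes circulant graphs out-regular.
  #-successors : ∀ (S : ℕ → Bool) u → # (λ v → S (diff u v)) ≡ # {n} (S ∘ toℕ)
  #-successors S u = trans
    (#-rotate (λ x → S (x % n)) n (λ x → cong S ([m+n]%n≡m%n x n)) (n ∸ toℕ u))
    (#-cong {n} (λ i → cong S (m<n⇒m%n≡m (toℕ<n i))))

  -- For fixed `v` the window is run through downwards as `u` grows, so it is reflected before being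
  -- rotated.
  #-predecessors : ∀ (S : ℕ → Bool) v → # (λ u → S (diff u v)) ≡ # {n} (S ∘ toℕ)
  #-predecessors S v = trans (#-reflect (λ x → S (x % n)) n (toℕ v)) (trans
    (#-rotate (λ x → S (x % n)) n (λ x → cong S ([m+n]%n≡m%n x n)) (suc (toℕ v)))
    (#-cong {n} (λ i → cong S (m<n⇒m%n≡m (toℕ<n i)))))

  -- The congruence of u + d and v modulo n. A multiple of n on either side avoids subtraction, and
  -- congruences then compose by adding up the multiples.
  record Displacement (u v : Fin n) (d : ℕ) : Set where
    constructor displacement
    field
      p q       : ℕ
      congruent : toℕ u + d + p * n ≡ toℕ v + q * n

  diff-displacement : ∀ u v → Displacement u v (diff u v)
  diff-displacement u v = displacement (X / n) 1 (begin
    toℕ u + X % n + X / n * n         ≡⟨ +-assoc (toℕ u) (X % n) _ ⟩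
    toℕ u + (X % n + X / n * n)       ≡⟨ cong (toℕ u +_) (m≡m%n+[m/n]*n X n) ⟨
    toℕ u + ((n ∸ toℕ u) + toℕ v)     ≡⟨ +-assoc (toℕ u) _ _ ⟨
    toℕ u + (n ∸ toℕ u) + toℕ v       ≡⟨ cong (_+ toℕ v) (m+[n∸m]≡n (<⇒≤ (toℕ<n u))) ⟩
    n + toℕ v                         ≡⟨ +-comm n (toℕ v) ⟩
    toℕ v + n                         ≡⟨ cong (toℕ v +_) (*-identityˡ n) ⟨
    toℕ v + 1 * n                     ∎)
    where
    open ≡-Reasoning
    X = (n ∸ toℕ u) + toℕ v

  infixr 5 _⊕_
  _⊕_ : ∀ {u v w d e} → Displacement u v d → Displacement v w e → Displacement u w (d + e)
  _⊕_ {u} {v} {w} {d} {e} (displacement p q α) (displacement p′ q′ β) =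
    displacement (p + p′) (q + q′) (begin
    toℕ u + (d + e) + (p + p′) * n          ≡⟨ l₁ (toℕ u) d e p p′ n ⟩
    (toℕ u + d + p * n) + (e + p′ * n)      ≡⟨ cong (_+ (e + p′ * n)) α ⟩
    (toℕ v + q * n) + (e + p′ * n)          ≡⟨ l₂ (toℕ v) e q p′ n ⟩
    (toℕ v + e + p′ * n) + q * n            ≡⟨ cong (_+ q * n) β ⟩
    (toℕ w + q′ * n) + q * n                ≡⟨ l₃ (toℕ w) q q′ n ⟩
    toℕ w + (q + q′) * n                    ∎)
    where
    open ≡-Reasoning
    l₁ : ∀ u d e p p′ n → u + (d + e) + (p + p′) * n ≡ (u + d + p * n) + (e + p′ * n)
    l₁ = solve-∀
    l₂ : ∀ v e q p′ n → (v + q * n) + (e + p′ * n) ≡ (v + e + p′ * n) + q * n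
    l₂ = solve-∀
    l₃ : ∀ w q q′ n → (w + q′ * n) + q * n ≡ w + (q + q′) * n
    l₃ = solve-∀

  -- The differences along a closed walk add up to a multiple of n; this reduces the exclusion of
  -- opposite arcs and of triangles to arithmetic.
  closed⇒∣ : ∀ {u d} → Displacement u u d → n ∣ d
  closed⇒∣ {u} {d} (displacement p q α) = ∣m+n∣m⇒∣n {n} {p * n} {d}
    (subst (n ∣_) (sym (trans (+-comm (p * n) d) (+-cancelˡ-≡ (toℕ u) _ _
      (trans (sym (+-assoc (toℕ u) d (p * n))) α)))) (n∣m*n q))
    (n∣m*n p)

  -- `diff-next` serves the steps of the 4-cycle that ascend below n, and `diff-wrap` the one that
  -- returns to 0.
  diff-next : ∀ {u v} d → d < n → toℕ u + d ≡ toℕ v → diff u v ≡ d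
  diff-next {u} {v} d d<n eq = begin
    ((n ∸ toℕ u) + toℕ v) % n         ≡⟨ cong (λ t → ((n ∸ toℕ u) + t) % n) eq ⟨
    ((n ∸ toℕ u) + (toℕ u + d)) % n   ≡⟨ cong (_% n) (+-assoc (n ∸ toℕ u) (toℕ u) d) ⟨
    ((n ∸ toℕ u) + toℕ u + d) % n     ≡⟨ cong (λ t → (t + d) % n) (m∸n+n≡m (<⇒≤ (toℕ<n u))) ⟩
    (n + d) % n                       ≡⟨ cong (_% n) (+-comm n d) ⟩
    (d + n) % n                       ≡⟨ [m+n]%n≡m%n d n ⟩
    d % n                             ≡⟨ m<n⇒m%n≡m d<n ⟩
    d                                 ∎
    where open ≡-Reasoning

  diff-wrap : ∀ {u v} d → d < n → toℕ u + d ≡ n → toℕ v ≡ 0 → diff u v ≡ d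
  diff-wrap {u} {v} d d<n eq v≡0 = begin
    ((n ∸ toℕ u) + toℕ v) % n   ≡⟨ cong (λ t → ((n ∸ toℕ u) + t) % n) v≡0 ⟩
    ((n ∸ toℕ u) + 0) % n       ≡⟨ cong (_% n) (+-identityʳ (n ∸ toℕ u)) ⟩
    (n ∸ toℕ u) % n             ≡⟨ cong (λ t → (t ∸ toℕ u) % n) eq ⟨
    (toℕ u + d ∸ toℕ u) % n     ≡⟨ cong (_% n) (m+n∸m≡n (toℕ u) d) ⟩
    d % n                       ≡⟨ m<n⇒m%n≡m d<n ⟩
    d                           ∎
    where open ≡-Reasoning

-- The circulant graph on 2h vertices

module Circulant (k l : ℕ) (1≤k : 1 ≤ k) (l≤k : l ≤ k) where

  h : ℕ
  h = suc (k + k + l)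

  open Cyclic (h + h)

  arcSet edgeSet : ℕ → Bool
  arcSet  d = interval 1 k d ∨ interval (suc h) l d
  edgeSet d = interval h 1 d

  data ArcResidue : ℕ → Set where
    short : ∀ {j} → j < k → ArcResidue (suc j)
    long  : ∀ {j} → j < l → ArcResidue (h + suc j)

  -- The differences of steps of both kinds. The edge difference h is the long residue with j = 0,
  -- so triangles can be excluded without telling edges from arcs.
  data Residue : ℕ → Set where
    short : ∀ {j} → j < k → Residue (suc j)
    long  : ∀ {j} → j ≤ l → Residue (h + j)

  arcSet⇒residue : ∀ d → T (arcSet d) → ArcResidue d
  arcSet⇒residue d t with Equivalence.to (T-∨ {interval 1 k d}) t
  ... | inj₁ t′ with j , j<k , refl ← ∈-interval⁻ 1 k d t′ = short j<k
  ... | inj₂ t′ with j , j<l , refl ← ∈-interval⁻ (suc h) l d t′ =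
    subst ArcResidue (+-suc h j) (long j<l)

  edgeSet⇒≡h : ∀ d → T (edgeSet d) → d ≡ h
  edgeSet⇒≡h d t with ∈-interval⁻ h 1 d t
  ... | zero  , _ , d≡h+0   = trans d≡h+0 (+-identityʳ h)
  ... | suc _ , s≤s () , _

  h∈edgeSet : T (edgeSet h)
  h∈edgeSet = subst (T ∘ edgeSet) (+-identityʳ h) (∈-interval⁺ h 1 z<s)

  k+k+l<h : k + k + l < h
  k+k+l<h = n<1+n (k + k + l)

  k<h : k < h
  k<h = s≤s (≤-trans (m≤m+n k k) (m≤m+n (k + k) l))

  l<h : l < h
  l<h = ≤-<-trans l≤k k<h

  h+h∤ : ∀ {m} → 0 < m → m < h + h → h + h ∤ m
  h+h∤ 0<m m<h+h h+h∣m = <⇒≱ m<h+h (∣⇒≤ {{>-nonZero 0<m}} h+h∣m)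

  h+h∤h+h+ : ∀ {m} → 0 < m → m < h + h → h + h ∤ (h + h) + m
  h+h∤h+h+ 0<m m<h+h h+h∣ = h+h∤ 0<m m<h+h (∣m+n∣m⇒∣n h+h∣ ∣-refl)

  regroup₂ : ∀ a i j → (a + i) + (a + j) ≡ (a + a) + (i + j)
  regroup₂ = solve-∀

  -- With at most one long residue the sum is positive and below 2h; with two it lies strictly
  -- between 2h and 4h.
  arcs-asym : ∀ {d e} → ArcResidue d → ArcResidue e → h + h ∤ d + e
  arcs-asym (short i<k) (short j<k) = h+h∤ z<s (+-mono-< (≤-<-trans i<k k<h) (≤-<-trans j<k k<h))
  arcs-asym (long {i} i<l) (short {j} j<k) = h+h∤ z<s (begin-strict
    h + suc i + suc j     ≡⟨ +-assoc h (suc i) (suc j) ⟩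
    h + (suc i + suc j)   ≤⟨ +-monoʳ-≤ h (+-mono-≤ i<l j<k) ⟩
    h + (l + k)           ≤⟨ +-monoʳ-≤ h (+-mono-≤ l≤k (m≤m+n k l)) ⟩
    h + (k + (k + l))     ≡⟨ cong (h +_) (+-assoc k k l) ⟨
    h + (k + k + l)       <⟨ +-monoʳ-< h k+k+l<h ⟩
    h + h                 ∎)
    where open ≤-Reasoning
  arcs-asym (short {i} i<k) (long {j} j<l) =
    arcs-asym (long j<l) (short i<k) ∘ subst (h + h ∣_) (+-comm (suc i) (h + suc j))
  arcs-asym (long {i} i<l) (long {j} j<l) =
    h+h∤h+h+ z<s (+-mono-< (≤-<-trans i<l l<h) (≤-<-trans j<l l<h))
      ∘ subst (h + h ∣_) (regroup₂ h (suc i) (suc j))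

  rotate : ∀ {m} a b c → m ∣ a + (b + c) → m ∣ b + (c + a)
  rotate {m} a b c = subst (m ∣_) (trans (+-comm a (b + c)) (+-assoc b c a))

  -- Three residues, e > 0 of them long, add up to e * h + r with r ≤ k + k + l < h, and r > 0 if
  -- e = 2; three short ones add up to less than h + h.
  no-short : ∀ {a b c} → a < k → b < k → c < k → h + h ∤ suc a + (suc b + suc c)
  no-short {a} {b} {c} a<k b<k c<k = h+h∤ z<s (begin-strict
    suc a + (suc b + suc c)   ≤⟨ +-mono-≤ a<k (+-mono-≤ b<k c<k) ⟩
    k + (k + k)               <⟨ +-mono-< k<h (s≤s (m≤m+n (k + k) l)) ⟩
    h + h                     ∎)
    where open ≤-Reasoning

  no-long-short : ∀ {a b c} → a ≤ l → b < k → c < k → h + h ∤ h + a + (suc b + suc c)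
  no-long-short {a} {b} {c} a≤l b<k c<k = h+h∤ z<s (begin-strict
    h + a + (suc b + suc c)   ≤⟨ +-mono-≤ (+-monoʳ-≤ h a≤l) (+-mono-≤ b<k c<k) ⟩
    h + l + (k + k)           ≡⟨ +-assoc h l (k + k) ⟩
    h + (l + (k + k))         ≡⟨ cong (h +_) (+-comm l (k + k)) ⟩
    h + (k + k + l)           <⟨ +-monoʳ-< h k+k+l<h ⟩
    h + h                     ∎)
    where open ≤-Reasoning

  no-long-long : ∀ {a b c} → a ≤ l → b ≤ l → 0 < c → c ≤ k → h + h ∤ h + a + (h + b + c)
  no-long-long {a} {b} {c} a≤l b≤l 0<c c≤k =
    h+h∤h+h+ (≤-trans 0<c (m≤n+m c (a + b))) (begin-strict
      a + b + c         ≤⟨ +-mono-≤ (+-mono-≤ (≤-trans a≤l l≤k) b≤l) c≤k ⟩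
      k + l + k         ≡⟨ +-assoc k l k ⟩
      k + (l + k)       ≡⟨ cong (k +_) (+-comm l k) ⟩
      k + (k + l)       ≡⟨ +-assoc k k l ⟨
      k + k + l         <⟨ k+k+l<h ⟩
      h                 ≤⟨ m≤m+n h h ⟩
      h + h             ∎)
    ∘ subst (h + h ∣_) (regroup h a b c)
    where
    open ≤-Reasoning
    regroup : ∀ h a b c → h + a + (h + b + c) ≡ h + h + (a + b + c)
    regroup = solve-∀

  no-long : ∀ {a b c} → a ≤ l → b ≤ l → c ≤ l → h + h ∤ h + a + (h + b + (h + c))
  no-long {a} {b} {c} a≤l b≤l c≤l =
    h+h∤h+h+ z<s (begin-strict
      h + (a + b + c)   ≤⟨ +-monoʳ-≤ h (+-mono-≤ (+-mono-≤ (≤-trans a≤l l≤k) (≤-trans b≤l l≤k)) c≤l) ⟩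
      h + (k + k + l)   <⟨ +-monoʳ-< h k+k+l<h ⟩
      h + h             ∎)
    ∘ subst (h + h ∣_) (regroup h a b c)
    where
    open ≤-Reasoning
    regroup : ∀ h a b c → h + a + (h + b + (h + c)) ≡ h + h + (h + (a + b + c))
    regroup = solve-∀

  -- Only the number of long residues matters: the first four cases treat one order for each number,
  -- and the others are cyclic rotations of these.
  no-triangle : ∀ {c d e} → Residue c → Residue d → Residue e → h + h ∤ c + (d + e)
  no-triangle (short a<k) (short b<k) (short c<k) = no-short a<k b<k c<k
  no-triangle (long a≤l)  (short b<k) (short c<k) = no-long-short a≤l b<k c<k
  no-triangle (long a≤l)  (long b≤l)  (short c<k) = no-long-long a≤l b≤l z<s c<k
  no-triangle (long a≤l)  (long b≤l)  (long c≤l)  = no-long a≤l b≤l c≤l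
  no-triangle {c} {d} {e} (short a<k) (long b≤l)  (short c<k) =
    no-long-short b≤l c<k a<k ∘ rotate c d e
  no-triangle {c} {d} {e} (short a<k) (long b≤l)  (long c≤l)  =
    no-long-long b≤l c≤l z<s a<k ∘ rotate c d e
  no-triangle {c} {d} {e} (short a<k) (short b<k) (long c≤l)  =
    no-long-short c≤l a<k b<k ∘ rotate d e c ∘ rotate c d e
  no-triangle {c} {d} {e} (long a≤l)  (short b<k) (long c≤l)  =
    no-long-long c≤l a≤l z<s b<k ∘ rotate d e c ∘ rotate c d e

  h∤ : ¬ (h + h ∣ h)
  h∤ = h+h∤ z<s (m<m+n h z<s)

  -- The sum h + d lies from h up to but excluding 3h, where the only multiple of 2h is 2h. Hence an
  -- edge has difference h in both directions.
  edges-sym : ∀ {d} → d < h + h → h + h ∣ h + d → d ≡ h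
  edges-sym {d} d<h+h h+h∣ with <-cmp d h
  ... | tri< d<h _ _ = ⊥-elim (h+h∤ z<s (+-monoʳ-< h d<h) h+h∣)
  ... | tri≈ _ d≡h _ = d≡h
  ... | tri> _ _ h<d with i , refl ← m≤n⇒∃[o]m+o≡n h<d =
    ⊥-elim (h+h∤h+h+ {suc i} z<s (≤-<-trans (s≤s (m≤n+m i h)) d<h+h)
      (subst (h + h ∣_) (trans (cong (h +_) (sym (+-suc h i))) (sym (+-assoc h h (suc i)))) h+h∣))

  G : MixedGraph (h + h)
  G = record
    { edge          = λ u v → edgeSet (diff u v)
    ; arc           = λ u v → arcSet (diff u v)
    ; edge-sym      = λ {u} {v} e → subst (T ∘ edgeSet)
        (sym (edges-sym (m%n<n ((h + h ∸ toℕ v) + toℕ u) (h + h))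
          (subst (λ d → h + h ∣ d + diff v u) (edgeSet⇒≡h (diff u v) e)
            (closed⇒∣ (diff-displacement u v ⊕ diff-displacement v u)))))
        h∈edgeSet
    ; edge-loopless = λ v e →
        h∤ (subst (h + h ∣_) (edgeSet⇒≡h (diff v v) e) (closed⇒∣ (diff-displacement v v)))
    ; arc-asym      = λ {u} {v} a b →
        arcs-asym (arcSet⇒residue (diff u v) a) (arcSet⇒residue (diff v u) b)
          (closed⇒∣ (diff-displacement u v ⊕ diff-displacement v u))
    ; edge-arc-disj = λ {u} {v} e a →
        h-not-arc (edgeSet⇒≡h (diff u v) e) (arcSet⇒residue (diff u v) a)
    }
    where
    h-not-arc : ∀ {d} → d ≡ h → ¬ ArcResidue d
    h-not-arc eq (short j<k) = <-irrefl eq (≤-<-trans j<k k<h)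
    h-not-arc eq (long {j} j<l) = m+1+n≢m h eq

  open MixedGraph G

  step⇒residue : ∀ {u v} → Step G u v → Residue (diff u v)
  step⇒residue {u} {v} (along-edge e) =
    subst Residue (trans (+-identityʳ h) (sym (edgeSet⇒≡h (diff u v) e))) (long z≤n)
  step⇒residue {u} {v} (along-arc a) = weaken (arcSet⇒residue (diff u v) a)
    where
    weaken : ∀ {d} → ArcResidue d → Residue d
    weaken (short j<k) = short j<k
    weaken (long j<l)  = long j<l

  residue⇒step : ∀ {u v d} → diff u v ≡ d → Residue d → Step G u v
  residue⇒step eq (short j<k) = along-arc (subst (T ∘ arcSet) (sym eq)
    (Equivalence.from T-∨ (inj₁ (∈-interval⁺ 1 k j<k))))
  residue⇒step eq (long {zero} _) = along-edge (subst (T ∘ edgeSet) (sym eq) (∈-interval⁺ h 1 z<s))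
  residue⇒step eq (long {suc j} j<l) = along-arc (subst (T ∘ arcSet) (sym (trans eq (+-suc h j)))
    (Equivalence.from (T-∨ {interval 1 k (suc h + j)}) (inj₂ (∈-interval⁺ (suc h) l j<l))))

  triangleFree : TriangleFree G
  triangleFree a b c s t u = no-triangle (step⇒residue s) (step⇒residue t) (step⇒residue u)
    (closed⇒∣ (diff-displacement a b ⊕ diff-displacement b c ⊕ diff-displacement c a))

  -- The cycle runs through 0, k, 2k and 2k + 1. Its closing step, of difference h + l, is an arc if
  -- l > 0 and an edge if l = 0.
  fourCycle : FourCycle G
  fourCycle = vertex p₀ , vertex p₁ , vertex p₂ , vertex p₃ ,
    ( distinct p₀ p₁ 1≤k , distinct p₀ p₂ (<-trans 1≤k k<2k) , distinct p₀ p₃ z<s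
    , distinct p₁ p₂ k<2k , distinct p₁ p₃ (<-trans k<2k (n<1+n _)) , distinct p₂ p₃ (n<1+n _)) ,
    ( residue⇒step (next p₀ p₁ k refl) k-residue
    , residue⇒step (next p₁ p₂ k refl) k-residue
    , residue⇒step (next p₂ p₃ 1 (+-comm (k + k) 1)) (short 1≤k)
    , residue⇒step (diff-wrap {vertex p₃} {vertex p₀} (h + l) (+-monoʳ-< h l<h)
        (trans (cong (_+ (h + l)) (toℕ-fromℕ< p₃)) (return k l)) (toℕ-fromℕ< p₀)) (long ≤-refl))
    where
    vertex : ∀ {m} → m < h + h → Fin (h + h)
    vertex m<h+h = fromℕ< m<h+h

    p₃ : suc (k + k) < h + h
    p₃ = s≤s (≤-trans (s≤s (m≤m+n (k + k) l)) (m≤n+m h (k + k + l)))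

    p₂ : k + k < h + h
    p₂ = <-trans (n<1+n _) p₃

    k<2k : k < k + k
    k<2k = m<m+n k 1≤k

    p₁ : k < h + h
    p₁ = <-trans k<2k p₂

    p₀ : 0 < h + h
    p₀ = z<s

    distinct : ∀ {i j} (i<n : i < h + h) (j<n : j < h + h) → i < j → vertex i<n ≢ vertex j<n
    distinct i<n j<n i<j eq =
      <⇒≢ i<j (trans (sym (toℕ-fromℕ< i<n)) (trans (cong toℕ eq) (toℕ-fromℕ< j<n)))

    next : ∀ {i j} (i<n : i < h + h) (j<n : j < h + h) d → i + d ≡ j →
           diff (vertex i<n) (vertex j<n) ≡ d
    next {i} {j} i<n j<n d eq = diff-next {vertex i<n} {vertex j<n} d
      (≤-<-trans (m≤n+m d i) (subst (_< h + h) (sym eq) j<n))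
      (trans (cong (_+ d) (toℕ-fromℕ< i<n)) (trans eq (sym (toℕ-fromℕ< j<n))))

    k-residue : Residue k
    k-residue with i , eq ← m≤n⇒∃[o]m+o≡n 1≤k = subst Residue eq (short (≤-reflexive eq))

    return : ∀ k l → suc (k + k) + (suc (k + k + l) + l) ≡ suc (k + k + l) + suc (k + k + l)
    return = solve-∀

  #-arcSet : # {h + h} (arcSet ∘ toℕ) ≡ k + l
  #-arcSet = trans
    (#-∨ {h + h} (interval 1 k ∘ toℕ) (interval (suc h) l ∘ toℕ) (λ i → disjoint (toℕ i)))
    (cong₂ _+_
      (#-interval 1 k (h + h) (≤-trans k<h (m≤m+n h h)))
      (#-interval (suc h) l (h + h) (subst (_≤ h + h) (+-suc h l) (+-monoʳ-≤ h l<h))))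
    where
    disjoint : ∀ d → T (interval 1 k d) → ¬ T (interval (suc h) l d)
    disjoint d s t with ∈-interval⁻ 1 k d s | ∈-interval⁻ (suc h) l d t
    ... | _ , i<k , refl | j , _ , eq =
      <⇒≢ (≤-<-trans i<k (<-≤-trans k<h (≤-trans (n≤1+n h) (m≤m+n (suc h) j)))) eq

  isMixedGraph : Is[ k + l , 1 ⨟ 4 ]MixedGraph G
  isMixedGraph = record
    { out-regular  = λ v → trans (#-successors arcSet v) #-arcSet
    ; in-regular   = λ v → trans (#-predecessors arcSet v) #-arcSet
    ; edge-regular = λ v → trans (#-successors edgeSet v)
        (#-interval h 1 (h + h) (+-monoʳ-≤ h (s≤s z≤n)))
    ; girth        = girth4⁺ fourCycle triangleFree
    }

-- Upper bound and the exact values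

realisable : ∀ z → 1 ≤ z → Realisable z 1 (2 * (z + suc ⌈ z /2⌉))
realisable z 1≤z = subst₂ (λ d m → Realisable d 1 m) degree order (C.G , C.isMixedGraph)
  where
  k = ⌈ z /2⌉
  l = ⌊ z /2⌋
  -- `⌈ z /2⌉` unfolds to `⌊ suc z /2⌋`, so 1 ≤ k is obtained by halving 2 ≤ z + 1.
  module C = Circulant k l (⌊n/2⌋-mono (s≤s 1≤z)) (⌊n/2⌋≤⌈n/2⌉ z)

  degree : k + l ≡ z
  degree = trans (+-comm k l) (⌊n/2⌋+⌈n/2⌉≡n z)

  regroup : ∀ k l → suc (k + k + l) + suc (k + k + l) ≡ 2 * (k + l + suc k)
  regroup = solve-∀

  order : suc (k + k + l) + suc (k + k + l) ≡ 2 * (z + suc k)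
  order = trans (regroup k l) (cong (λ d → 2 * (d + suc k)) degree)

cage-of-degree : ∀ z → 1 ≤ z → ∃ λ n → n ≤ 2 * (z + suc ⌈ z /2⌉) × (n[ z , 1 ⨟ 4 ]≐ n)
cage-of-degree z 1≤z = cage (realisable z 1≤z)

-- The lower bound and the construction agree for z ≤ 2 because then ⌈ z /2⌉ is 1.
cage-of-small-degree : ∀ z → 1 ≤ z → ⌈ z /2⌉ ≡ 1 → n[ z , 1 ⨟ 4 ]≐ (2 * (z + 2))
cage-of-small-degree z 1≤z ⌈z/2⌉≡1 with cage-of-degree z 1≤z
... | n , n≤ , G , G-cage = subst (n[ z , 1 ⨟ 4 ]≐_)
  (≤-antisym (subst (λ k → n ≤ 2 * (z + suc k)) ⌈z/2⌉≡1 n≤)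
             (2z+4≤n (Is[_,_⨟_]MixedCage.isMixedGraph G-cage) 1≤z))
  (G , G-cage)

theorem9 : (∀ (z : ℕ) → 1 ≤ z →
    ∃ λ (n : ℕ) → (n[ z , 1 ⨟ 4 ]≐ n) ×
    (2 ∤ z → n ≤ 3 * (z + 1)) ×
    (2 ∣ z → n ≤ 3 * z + 2)) ×
    (n[ 1 , 1 ⨟ 4 ]≐ 6) ×
    (n[ 2 , 1 ⨟ 4 ]≐ 8)
theorem9 = bounds , cage-of-small-degree 1 ≤-refl refl , cage-of-small-degree 2 z<s refl
  where
  open ≤-Reasoning
  bounds : ∀ z → 1 ≤ z → ∃ λ n → (n[ z , 1 ⨟ 4 ]≐ n) ×
    (2 ∤ z → n ≤ 3 * (z + 1)) × (2 ∣ z → n ≤ 3 * z + 2)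
  bounds z 1≤z with n , n≤ , n-cage ← cage-of-degree z 1≤z = n , n-cage , odd , even
    where
    odd : 2 ∤ z → n ≤ 3 * (z + 1)
    odd _ = begin
      n                                     ≤⟨ n≤ ⟩
      2 * (z + suc ⌈ z /2⌉)                 ≡⟨ l₁ z ⌈ z /2⌉ ⟩
      -- As `⌈ z /2⌉` is `⌊ suc z /2⌋`, raising one copy to `⌈ suc z /2⌉` makes the two halves add
      -- up to z + 1.
      2 * (z + 1) + (⌈ z /2⌉ + ⌈ z /2⌉)     ≤⟨ +-monoʳ-≤ (2 * (z + 1)) (+-monoʳ-≤ ⌈ z /2⌉ (⌊n/2⌋≤⌈n/2⌉ (suc z))) ⟩
      2 * (z + 1) + (⌈ z /2⌉ + ⌈ suc z /2⌉) ≡⟨ cong (2 * (z + 1) +_) (⌊n/2⌋+⌈n/2⌉≡n (suc z)) ⟩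
      2 * (z + 1) + suc z                   ≡⟨ l₂ z ⟩
      3 * (z + 1)                           ∎
      where
      l₁ : ∀ z k → 2 * (z + suc k) ≡ 2 * (z + 1) + (k + k)
      l₁ = solve-∀
      l₂ : ∀ z → 2 * (z + 1) + suc z ≡ 3 * (z + 1)
      l₂ = solve-∀
    even : 2 ∣ z → n ≤ 3 * z + 2
    even (divides q refl) = begin
      n                                     ≤⟨ n≤ ⟩
      2 * (q * 2 + suc ⌈ q * 2 /2⌉)         ≡⟨ cong (λ k → 2 * (q * 2 + suc k)) half ⟩
      2 * (q * 2 + suc q)                   ≡⟨ l₁ q ⟩
      3 * (q * 2) + 2                       ∎
      where
      q+q : ∀ q → q * 2 ≡ q + q
      q+q = solve-∀
      half : ⌈ q * 2 /2⌉ ≡ q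
      half = trans (cong ⌈_/2⌉ (q+q q)) (sym (n≡⌈n+n/2⌉ q))
      l₁ : ∀ q → 2 * (q * 2 + suc q) ≡ 3 * (q * 2) + 2
      l₁ = solve-∀
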